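{- For any set $A\subseteq\{0,1\}^+$ that is $\mathbf P$-levelable and not $\mathbf{FPT}_{\mathrm{nu}}$-levelable, there is no parameterization $\eta$ with $(A,\eta)\in\mathbf{FPT}_{\mathrm{nu}}$ such that $\eta\preccurlyeq_{\mathrm{nu}}\eta'$ for every parameterization $\eta'$ with $(A,\eta')\in\mathbf{FPT}_{\mathrm{nu}}$; that is, the filter $\mathcal F^{\preccurlyeq_{\mathrm{nu}}}_{(A,\mathbf{FPT}_{\mathrm{nu}})}$ is nonprincipal.
   Context: A Turing machine $\Phi$ is a partial decision procedure for $A$ if $\Phi(x)=1\Rightarrow x\in A$ and $\Phi(x)=0\Rightarrow x\notin A$; $\mathrm{dom}(\Phi)=\{x:\Phi(x)\in\{0,1\}\}$. A $\mathbf P$-approximation (resp. $O(n^c)$-approximation) for $A$ is a partial decision procedure for $A$ halting on all inputs in polynomial time (resp. time $O(n^c)$); a $\mathbf P$-slice (resp. $O(n^c)$-slice) is the domain of such an approximation. A $\mathbf P$-slice $S$ for $A$ is maximal if $S'\setminus S$ is finite for every $\mathbf P$-slice $S'$ for $A$. $A$ is $\mathbf P$-levelable if it has no maximal $\mathbf P$-slice. A parameter space is a nonempty set $\Omega$ with a reflexive, transitive, directed relation $\preccurlyeq$ and an injective encoding into $\{0,1\}^+$; $|k|$ is the encoding length. A parameterization over $\Omega$ is $\eta\subseteq\{0,1\}^+\times\Omega$ such that for every $x$, $\{k:(x,k)\in\eta\}$ is nonempty and upward closed; $\eta_k=\{x:(x,k)\in\eta\}$. $\eta$ has imix if for every $k$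 there is $k'$ with $\eta_{k'}\setminus\eta_k$ infinite. $\mu_\eta(x)=\min\{|k|:(x,k)\in\eta\}$; $\mathrm{gap}_{\eta_1,\eta_2}(n)=\max\{\mu_{\eta_1}(x):\mu_{\eta_2}(x)\le n\}\in\mathbb N\cup\{\infty\}$ (max of empty set is $0$); $\eta_1\preccurlyeq_{\mathrm{nu}}\eta_2$ if $\mathrm{gap}_{\eta_1,\eta_2}(n)<\infty$ for all $n$. For a constant $c$, $(A,\eta)\in\mathbf{FPT}^c_{\mathrm{nu}}$ if every $\eta_k$ is an $O(n^c)$-slice for $A$; $(A,\eta)\in\mathbf{FPT}_{\mathrm{nu}}$ if $(A,\eta)\in\mathbf{FPT}^c_{\mathrm{nu}}$ for some $c$. $A$ is $\mathbf{FPT}_{\mathrm{nu}}$-levelable if there is $c_0$ such that for all $c\ge c_0$ there is $\eta$ with $(A,\eta)\in\mathbf{FPT}^c_{\mathrm{nu}}$ such that every $\eta'\preccurlyeq_{\mathrm{nu}}\eta$ with $(A,\eta')\in\mathbf{FPT}^c_{\mathrm{nu}}$ has imix. -}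

module Defs where

open import Data.Bool using (Bool; true; false)
open import Data.Nat using (ℕ; zero; suc; _+_; _*_; _^_; _≤_)
open import Data.Fin using (Fin)
open import Data.List using (List; []; _∷_; map)
open import Data.List.NonEmpty using (List⁺; _∷_; length)
open import Data.List.Membership.Propositional using (_∈_)
open import Data.Vec using (Vec; replicate; zipWith; zip) renaming (map to vmap; _∷_ to _∷v_)
open import Data.Maybe using (Maybe; just; nothing)
open import Data.Product using (Σ; ∃; _×_; _,_)
open import Data.Sum using (_⊎_)
open import Relation.Nullary using (¬_)
open import Relation.Binary.PropositionalEquality using (_≡_)

Str⁺ : Set
Str⁺ = List⁺ Bool

SetStr : Set₁
SetStr = Str⁺ → Set

Finite : SetStr → Set
Finite S = ∃ λ (l : List Str⁺) → ∀ x → S x → x ∈ l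

Infinite : SetStr → Set
Infinite S = ¬ Finite S

_∖_ : SetStr → SetStr → SetStr
(S ∖ T) x = S x × ¬ T x

-- Multitape Turing machines (tape alphabet {blank,0,1}, two-way infinite
-- tapes, input on tape 0, other tapes blank). On halting the machine
-- outputs a value of type Maybe Bool: just true = 1, just false = 0,
-- nothing = any other output ("?").

data Sym : Set where
  blank b0 b1 : Sym

data Move : Set where
  left right stay : Move

record Tape : Set where
  constructor tape
  field
    lft  : List Sym   -- cells to the left of the head, nearest first
    hd   : Sym
    rgt  : List Sym   -- cells to the right of the head, nearest first

data Step (Q K : ℕ) : Set where
  halt : Maybe Bool → Step Q K
  go   : Fin (suc Q) → Vec Sym (suc K) → Vec Move (suc K) → Step Q K

record TM : Set where
  field
    K : ℕ
    Q : ℕ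
    δ : Fin (suc Q) → Vec Sym (suc K) → Step Q K

moveTape : Move → Tape → Tape
moveTape left  (tape [] h r)      = tape [] blank (h ∷ r)
moveTape left  (tape (a ∷ l) h r) = tape l a (h ∷ r)
moveTape right (tape l h [])      = tape (h ∷ l) blank []
moveTape right (tape l h (a ∷ r)) = tape (h ∷ l) a r
moveTape stay  t                  = t

writeTape : Sym → Tape → Tape
writeTape s (tape l _ r) = tape l s r

bitSym : Bool → Sym
bitSym true  = b1
bitSym false = b0

blankTape : Tape
blankTape = tape [] blank []

inputTape : Str⁺ → Tape
inputTape (b ∷ bs) = tape [] (bitSym b) (map bitSym bs)

Config : TM → Set
Config M = Fin (suc (TM.Q M)) × Vec Tape (suc (TM.K M))

initConfig : (M : TM) → Str⁺ → Config M
initConfig M x = Fin.zero , (inputTape x ∷v replicate _ blankTape)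
  where import Data.Fin as Fin

run : (M : TM) → ℕ → Config M → Maybe (Maybe Bool)
run M zero    c       = nothing
run M (suc t) (q , ts) with TM.δ M q (vmap Tape.hd ts)
... | halt o      = just o
... | go q' ws ms = run M t (q' , zipWith moveTape ms (zipWith writeTape ws ts))

HaltsWithin : TM → Str⁺ → ℕ → Maybe Bool → Set
HaltsWithin M x t o = run M t (initConfig M x) ≡ just o

Outputs : TM → Str⁺ → Maybe Bool → Set
Outputs M x o = ∃ λ t → HaltsWithin M x t o

dom : TM → SetStr
dom M x = Outputs M x (just true) ⊎ Outputs M x (just false)

PartialDecision : SetStr → TM → Set
PartialDecision A M =
  ∀ x → (Outputs M x (just true) → A x) × (Outputs M x (just false) → ¬ A x)

-- M halts on all inputs within time O(n^c)
-- (|x| ≥ 1, so the bound a·|x|^c + a is equivalent to O(|x|^c))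
TimeBound : ℕ → TM → Set
TimeBound c M = ∃ λ a → ∀ x → ∃ λ t → ∃ λ o →
  t ≤ a * (length x ^ c) + a × HaltsWithin M x t o

Approx : ℕ → SetStr → TM → Set
Approx c A M = PartialDecision A M × TimeBound c M

Slice : ℕ → SetStr → SetStr → Set
Slice c A S = ∃ λ M → Approx c A M × (∀ x → (S x → dom M x) × (dom M x → S x))

PSlice : SetStr → SetStr → Set
PSlice A S = ∃ λ c → Slice c A S

MaximalPSlice : SetStr → SetStr → Set₁
MaximalPSlice A S = PSlice A S × (∀ S' → PSlice A S' → Finite (S' ∖ S))

PLevelable : SetStr → Set₁
PLevelable A = ¬ (Σ SetStr λ S → MaximalPSlice A S)

record ParamSpace : Set₁ where
  field
    Ω       : Set
    _≼_     : Ω → Ω → Set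
    ≼-refl  : ∀ k → k ≼ k
    ≼-trans : ∀ {i j k} → i ≼ j → j ≼ k → i ≼ k
    ≼-dir   : ∀ i j → ∃ λ k → i ≼ k × j ≼ k
    point   : Ω
    enc     : Ω → Str⁺
    enc-inj : ∀ {i j} → enc i ≡ enc j → i ≡ j

  ∣_∣ : Ω → ℕ
  ∣ k ∣ = length (enc k)

record Parameterization : Set₁ where
  field
    space  : ParamSpace
  open ParamSpace space public
  field
    η      : Str⁺ → Ω → Set
    η-ne   : ∀ x → ∃ λ k → η x k
    η-up   : ∀ {x k k'} → η x k → k ≼ k' → η x k'

  slice : Ω → SetStr
  slice k x = η x k

open Parameterization

-- μ_η(x) ≤ n  (μ_η(x) = min{|k| : (x,k) ∈ η}, so μ_η(x) ≤ n iff some k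
-- with (x,k) ∈ η has |k| ≤ n)
μ≤ : (η₁ : Parameterization) → Str⁺ → ℕ → Set
μ≤ P x n = ∃ λ k → η P x k × ∣_∣ P k ≤ n

-- η₁ ≼_nu η₂ : gap_{η₁,η₂}(n) < ∞ for all n, i.e. for every n there is m
-- bounding μ_{η₁}(x) for all x with μ_{η₂}(x) ≤ n
_≼nu_ : Parameterization → Parameterization → Set
P₁ ≼nu P₂ = ∀ n → ∃ λ m → ∀ x → μ≤ P₂ x n → μ≤ P₁ x m

Imix : Parameterization → Set
Imix P = ∀ k → ∃ λ k' → Infinite (slice P k' ∖ slice P k)

FPTc : ℕ → SetStr → Parameterization → Set
FPTc c A P = ∀ k → Slice c A (slice P k)

FPT : SetStr → Parameterization → Set
FPT A P = ∃ λ c → FPTc c A P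

FPTLevelable : SetStr → Set₁
FPTLevelable A = ∃ λ c₀ → ∀ c → c₀ ≤ c →
  Σ Parameterization λ P → FPTc c A P ×
    (∀ P' → P' ≼nu P → FPTc c A P' → Imix P')

{-# OPTIONS --safe #-}

-- Let P be a minimum.  Classically, P itself witnesses FPT-levelability: by
-- P-levelability every slice S of a given P' ≼nu P is infinitely exceeded by
-- some P-slice S', and S' is contained in a slice of P' because P ≼nu
-- {S' ∪ {x : |x| ≤ n}}, using directedness over the finitely many short codes.
-- Imix asks for the larger slice of P' as a witness, so this argument needs
-- omniscience.  Minimality supplies it: P ≼nu R bounds μ on the slice of a short
-- code of R even when it is unknown whether that code is in use, and this
-- yields the limited principle of omniscience for ℕ.  The search for S' among
-- all machines, and for the codes of P' that are hit by S', is then decidable.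

module Submission where

open import Defs
open import Data.Bool using (Bool; true; false)
import Data.Bool.Properties as Bool
open import Data.Empty using (⊥)
open import Data.Fin using (Fin; zero; suc; splitAt; _↑ˡ_; _↑ʳ_)
import Data.Fin.Properties as Fin
open import Data.List using (List; []; _∷_; _++_; map)
import Data.List as List
open import Data.List.Membership.Propositional using (_∈_)
open import Data.List.Membership.Propositional.Properties using (∈-map⁺; ∈-++⁺ˡ; ∈-++⁺ʳ)
open import Data.List.NonEmpty using (_∷_; length)
import Data.List.Properties as List
open import Data.List.Relation.Unary.Any using (here; there)
open import Data.Maybe using (Maybe; just; nothing)
import Data.Maybe.Properties as Maybe
open import Data.Nat using (ℕ; zero; suc; _+_; _*_; _^_; _≤_; _<_; _⊔_; _≤?_; _≟_; z≤n; s≤s)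
open import Data.Nat.Induction using (<-rec)
open import Data.Nat.Properties
open import Data.Product using (Σ; ∃; _×_; _,_; proj₁; proj₂)
open import Data.Sum using (_⊎_; inj₁; inj₂; [_,_]′)
open import Data.Unit using (tt)
open import Data.Vec using (Vec; []; _∷_; replicate; zipWith; lookup; tabulate; toList; fromList)
import Data.Vec as Vec
import Data.Vec.Properties as Vec
open import Function using (_∘_; id)
open import Relation.Binary.Definitions using (DecidableEquality; tri<; tri≈; tri>)
open import Relation.Binary.PropositionalEquality using (_≡_; refl; sym; trans; cong; cong₂; subst)
open import Relation.Nullary using (¬_; Dec; yes; no; contradiction; recompute)
open import Relation.Nullary.Decidable using (map′; _×-dec_; _→-dec_; ¬?; decidable-stable; ¬¬-excluded-middle; True; toWitness; fromWitness)

-- The second decision may use the proof of the first: the domain of a machine is decidable once the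
-- machine is known to be valid.
_×-dec′_ : ∀ {X Y : Set} → Dec X → (X → Dec Y) → Dec (X × Y)
yes x ×-dec′ Y? = map′ (x ,_) proj₂ (Y? x)
no ¬x ×-dec′ Y? = no (¬x ∘ proj₁)

-- Strings of bounded length

lists≤ : ℕ → List (List Bool)
lists≤ zero    = [] ∷ []
lists≤ (suc n) = [] ∷ map (false ∷_) (lists≤ n) ++ map (true ∷_) (lists≤ n)

∈-lists≤ : ∀ n l → List.length l ≤ n → l ∈ lists≤ n
∈-lists≤ zero    []          _       = here refl
∈-lists≤ (suc n) []          _       = here refl
∈-lists≤ (suc n) (false ∷ l) (s≤s h) = there (∈-++⁺ˡ (∈-map⁺ (false ∷_) (∈-lists≤ n l h)))
∈-lists≤ (suc n) (true ∷ l)  (s≤s h) = there (∈-++⁺ʳ _ (∈-map⁺ (true ∷_) (∈-lists≤ n l h)))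

strings≤ : ℕ → List Str⁺
strings≤ n = map (false ∷_) (lists≤ n) ++ map (true ∷_) (lists≤ n)

∈-strings≤ : ∀ n x → length x ≤ n → x ∈ strings≤ n
∈-strings≤ n (false ∷ l) h = ∈-++⁺ˡ (∈-map⁺ (false ∷_) (∈-lists≤ n l (<⇒≤ h)))
∈-strings≤ n (true ∷ l)  h = ∈-++⁺ʳ _ (∈-map⁺ (true ∷_) (∈-lists≤ n l (<⇒≤ h)))

length-bound : ∀ (l : List Str⁺) → ∃ λ n → ∀ x → x ∈ l → length x ≤ n
length-bound []      = 0 , λ _ ()
length-bound (y ∷ l) with length-bound l
... | n , h = length y ⊔ n , λ where
  x (here refl) → m≤m⊔n (length y) n
  x (there x∈l) → ≤-trans (h x x∈l) (m≤n⊔m (length y) n)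

_≟ˢ_ : DecidableEquality Str⁺
(b ∷ l) ≟ˢ (b′ ∷ l′) =
  map′ (λ (p , q) → cong₂ _∷_ p q) (λ where refl → refl , refl)
       ((b Bool.≟ b′) ×-dec List.≡-dec Bool._≟_ l l′)

-- Turing machines

run-mono : ∀ M {t t′ o} c → t ≤ t′ → run M t c ≡ just o → run M t′ c ≡ just o
run-mono M {zero}  c        _       ()
run-mono M {suc t} (q , ts) (s≤s h) e with TM.δ M q (Vec.map Tape.hd ts)
... | halt o      = e
... | go q′ ws ms = run-mono M _ h e

Outputs-unique : ∀ M x {o o′} → Outputs M x o → Outputs M x o′ → o ≡ o′
Outputs-unique M x (t , h) (t′ , h′) = Maybe.just-injective
  (trans (sym (run-mono M {t} _ (m≤m+n t t′) h)) (run-mono M {t′} _ (m≤n+m t′ t) h′))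

dom-just : ∀ M x b → Outputs M x (just b) → dom M x
dom-just M x true  = inj₁
dom-just M x false = inj₂

dom-output : ∀ M x → dom M x → ∃ λ b → Outputs M x (just b)
dom-output M x (inj₁ h) = true , h
dom-output M x (inj₂ h) = false , h

-- Combining programs with a common number of tapes.

record Program (K : ℕ) : Set where
  field
    Q : ℕ
    δ : Fin (suc Q) → Vec Sym (suc K) → Step Q K

machine : ∀ {K} → Program K → TM
machine {K} N = record { K = K ; Q = Program.Q N ; δ = Program.δ N }

program : (M : TM) → Program (TM.K M)
program M = record { Q = TM.Q M ; δ = TM.δ M }

mapStep : ∀ {Q Q′ K} → (Fin (suc Q) → Fin (suc Q′)) → Step Q K → Step Q′ K
mapStep f (halt o)     = halt o
mapStep f (go q ws ms) = go (f q) ws ms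

mapStep-id : ∀ {Q K} (s : Step Q K) → s ≡ mapStep id s
mapStep-id (halt _)   = refl
mapStep-id (go _ _ _) = refl

-- A run carried along `f` stays in the image of `f`, so both machines move in lockstep. With `f`
-- the identity this replaces function extensionality for `δ`.
run-embed : ∀ {K} (N N′ : Program K) f →
  (∀ q s → Program.δ N′ (f q) s ≡ mapStep f (Program.δ N q s)) →
  ∀ t q ts → run (machine N′) t (f q , ts) ≡ run (machine N) t (q , ts)
run-embed N N′ f eq zero    q ts = refl
run-embed N N′ f eq (suc t) q ts rewrite eq q (Vec.map Tape.hd ts)
  with Program.δ N q (Vec.map Tape.hd ts)
... | halt o      = refl
... | go q′ ws ms = run-embed N N′ f eq t q′ _

Runs : ∀ {K} → Program K → ℕ → Vec Tape (suc K) → Maybe Bool → Set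
Runs N t ts o = run (machine N) t (zero , ts) ≡ just o

moveInput : ∀ {K Q} → Fin (suc Q) → Move → Vec Sym (suc K) → Step Q K
moveInput q m s = go q s (m ∷ replicate _ stay)

write-read : ∀ {n} (ts : Vec Tape n) → zipWith writeTape (Vec.map Tape.hd ts) ts ≡ ts
write-read []       = refl
write-read (t ∷ ts) = cong (t ∷_) (write-read ts)

move-stay : ∀ {n} (ts : Vec Tape n) → zipWith moveTape (replicate n stay) ts ≡ ts
move-stay []       = refl
move-stay (t ∷ ts) = cong (t ∷_) (move-stay ts)

moveInput-tapes : ∀ {n} m t (ts : Vec Tape n) →
  zipWith moveTape (m ∷ replicate n stay)
    (zipWith writeTape (Vec.map Tape.hd (t ∷ ts)) (t ∷ ts)) ≡ moveTape m t ∷ ts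
moveInput-tapes m t ts rewrite write-read ts | move-stay ts = refl

back : ∀ {K} → Program K → Program K
back {K} N = record { Q = suc (Program.Q N) ; δ = δ }
  where
  δ : Fin (suc (suc (Program.Q N))) → Vec Sym (suc K) → Step _ K
  δ zero    s = moveInput (suc zero) left s
  δ (suc q) s = mapStep suc (Program.δ N q s)

run-back : ∀ {K} (N : Program K) {t o} τ ts →
  Runs N t (moveTape left τ ∷ ts) o → Runs (back N) (suc t) (τ ∷ ts) o
run-back N {t} τ ts h rewrite moveInput-tapes left τ ts =
  trans (run-embed N (back N) suc (λ _ _ → refl) t zero _) h

branch : ∀ {K} → Maybe Bool → Move → (Bool → Program K) → Program K
branch {K} o m N = record { Q = Q₀ + Q₁ ; δ = δ }
  where
  Q₀ = suc (Program.Q (N false))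
  Q₁ = suc (Program.Q (N true))

  δ : Fin (suc (Q₀ + Q₁)) → Vec Sym (suc K) → Step (Q₀ + Q₁) K
  δ zero (blank ∷ s) = halt o
  δ zero (b0 ∷ s)    = moveInput (suc (zero ↑ˡ Q₁)) m (b0 ∷ s)
  δ zero (b1 ∷ s)    = moveInput (suc (Q₀ ↑ʳ zero)) m (b1 ∷ s)
  δ (suc q) s =
    [ (λ r → mapStep (λ r′ → suc (r′ ↑ˡ Q₁)) (Program.δ (N false) r s))
    , (λ r → mapStep (λ r′ → suc (Q₀ ↑ʳ r′)) (Program.δ (N true) r s)) ]′ (splitAt Q₀ q)

-- `l` holds the symbols already passed and `v` the unread bits; behind the end of the input the
-- head is on a blank.
tapeAt : List Sym → List Bool → Tape
tapeAt l []      = tape l blank []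
tapeAt l (b ∷ v) = tape l (bitSym b) (map bitSym v)

move-right : ∀ l b v → moveTape right (tapeAt l (b ∷ v)) ≡ tapeAt (bitSym b ∷ l) v
move-right l b []      = refl
move-right l b (_ ∷ _) = refl

run-branch : ∀ {K} o m (N : Bool → Program K) {t o′} l b v ts →
  Runs (N b) t (moveTape m (tapeAt l (b ∷ v)) ∷ ts) o′ →
  Runs (branch o m N) (suc t) (tapeAt l (b ∷ v) ∷ ts) o′
run-branch o m N {t} l false v ts h
  rewrite moveInput-tapes m (tapeAt l (false ∷ v)) ts =
  trans (run-embed (N false) (branch o m N) inject δ-inject t zero _) h
  where
  Q₀ = suc (Program.Q (N false))
  Q₁ = suc (Program.Q (N true))
  inject : Fin Q₀ → Fin (suc (Q₀ + Q₁))
  inject q = suc (q ↑ˡ Q₁)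
  δ-inject : ∀ q s → Program.δ (branch o m N) (inject q) s ≡ mapStep inject (Program.δ (N false) q s)
  δ-inject q s rewrite Fin.splitAt-↑ˡ Q₀ q Q₁ = refl
run-branch o m N {t} l true v ts h
  rewrite moveInput-tapes m (tapeAt l (true ∷ v)) ts =
  trans (run-embed (N true) (branch o m N) inject δ-inject t zero _) h
  where
  Q₀ = suc (Program.Q (N false))
  Q₁ = suc (Program.Q (N true))
  inject : Fin Q₁ → Fin (suc (Q₀ + Q₁))
  inject q = suc (Q₀ ↑ʳ q)
  δ-inject : ∀ q s → Program.δ (branch o m N) (inject q) s ≡ mapStep inject (Program.δ (N true) q s)
  δ-inject q s rewrite Fin.splitAt-↑ʳ Q₀ Q₁ q = refl

-- Inputs of length at most d are answered from the table k.  On longer inputs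
-- the head never meets a blank, so going back restores the input tape exactly
-- before N is started.
trie : ∀ {K} → ℕ → (List Bool → Maybe Bool) → Program K → Program K
trie zero    k N = branch (k []) stay (λ _ → N)
trie (suc d) k N = branch (k []) right (λ b → trie d (k ∘ (b ∷_)) (back N))

run-trie-short : ∀ {K} d k (N : Program K) l v ts → List.length v ≤ d →
  Runs (trie d k N) (suc d) (tapeAt l v ∷ ts) (k v)
run-trie-short zero    k N l []      ts _ = refl
run-trie-short (suc d) k N l []      ts _ = refl
run-trie-short (suc d) k N l (b ∷ v) ts (s≤s h) =
  run-branch (k []) right _ l b v ts
    (subst (λ τ → Runs (trie d (k ∘ (b ∷_)) (back N)) (suc d) (τ ∷ ts) (k (b ∷ v)))
      (sym (move-right l b v))
      (run-trie-short d (k ∘ (b ∷_)) (back N) (bitSym b ∷ l) v ts h))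

-- The time is `d` moves to the right, one reading step that stays, `d` moves back, and then `t`.
run-trie-long : ∀ {K} d k (N : Program K) {t o} l v ts → d < List.length v →
  Runs N t (tapeAt l v ∷ ts) o → Runs (trie d k N) (suc (d + (d + t))) (tapeAt l v ∷ ts) o
run-trie-long zero    k N l (b ∷ v) ts _ h = run-branch (k []) stay _ l b v ts h
run-trie-long (suc d) k N {t} {o} l (b ∷ v@(_ ∷ _)) ts (s≤s d<v) h =
  subst (λ n → Runs (trie (suc d) k N) (suc (suc n)) (tapeAt l (b ∷ v) ∷ ts) o)
    (cong (d +_) (+-suc d t))
    (run-branch (k []) right _ l b v ts
      (run-trie-long d (k ∘ (b ∷_)) (back N) (bitSym b ∷ l) v ts d<v
        (run-back N {t} (tapeAt (bitSym b ∷ l) v) ts h)))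

-- Slices

-- The machine of a slice halts everywhere, so its output can be computed; uniqueness of outputs
-- excludes `x` when the output is `nothing`.
Slice-dec : ∀ c {A S} → Slice c A S → ∀ x → Dec (S x)
Slice-dec c (M , (_ , _ , halts) , iff) x with halts x
... | t , just b  , _ , h = yes (proj₂ (iff x) (dom-just M x b (t , h)))
... | t , nothing , _ , h = no λ s →
  contradiction (Outputs-unique M x (t , h) (proj₂ (dom-output M x (proj₁ (iff x) s)))) λ ()

Slice-mono : ∀ c {c′ A S} → c ≤ c′ → Slice c A S → Slice c′ A S
Slice-mono c {c′} c≤c′ (M , (pd , a , halts) , iff) = M , (pd , a , halts′) , iff
  where
  halts′ : ∀ x → ∃ λ t → ∃ λ o → t ≤ a * length x ^ c′ + a × HaltsWithin M x t o
  -- Matching on `x` exposes its length as a successor: monotonicity in the exponent needs a nonzero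
  -- base.
  halts′ x@(_ ∷ _) with halts x
  ... | t , o , t≤ , h =
    t , o , ≤-trans t≤ (+-monoˡ-≤ a (*-monoʳ-≤ a (^-monoʳ-≤ (length x) c≤c′))) , h

Slice-∅ : ∀ A → Slice 0 A (λ _ → ⊥)
Slice-∅ A = M , ((λ x → (λ h → nothing≢just (out x h)) , (λ h → nothing≢just (out x h)))
                , 1 , λ x → 1 , nothing , s≤s z≤n , refl)
          , λ x → (λ ()) , λ h → nothing≢just (out x (proj₂ (dom-output M x h)))
  where
  M : TM
  M = record { K = 0 ; Q = 0 ; δ = λ _ _ → halt nothing }
  out : ∀ x {o} → Outputs M x o → nothing ≡ o
  out x = Outputs-unique M x (1 , refl)
  nothing≢just : ∀ {b : Bool} {X : Set} → nothing ≡ just b → X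
  nothing≢just ()

_∪≤_ : SetStr → ℕ → SetStr
(S ∪≤ d) x = S x ⊎ length x ≤ d

-- The decision of `A` on short strings fills the table of a `trie`. Longer inputs pay only the
-- constant overhead `suc (d + d)`, so the exponent `c` is kept.
Slice-∪≤ : ∀ c {A S} → (∀ x → Dec (A x)) → ∀ d → Slice c A S → Slice c A (S ∪≤ d)
Slice-∪≤ c {A} {S} A? d (M , (pd , a , halts) , iff) = M′ , (pd′ , a′ , halts′) , iff′
  where
  answer : ∀ {x} → Dec (A x) → Bool
  answer (yes _) = true
  answer (no _)  = false

  table : List Bool → Maybe Bool
  -- Inputs are nonempty, so this is an arbitrary default.
  table []       = nothing
  table (b ∷ bs) = just (answer (A? (b ∷ bs)))

  M′ : TM
  M′ = machine (trie d table (program M))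

  a′ : ℕ
  a′ = suc (d + d) + a

  short : ∀ x → length x ≤ d → HaltsWithin M′ x (suc d) (just (answer (A? x)))
  short (b ∷ bs) h = run-trie-short d table (program M) [] (b ∷ bs) _ h

  long : ∀ x {t o} → ¬ length x ≤ d → HaltsWithin M x t o → HaltsWithin M′ x (suc (d + (d + t))) o
  long (b ∷ bs) {t} h = run-trie-long d table (program M) {t} [] (b ∷ bs) _ (≰⇒> h)

  long⁻ : ∀ x {o} → ¬ length x ≤ d → Outputs M′ x o → Outputs M x o
  long⁻ x x≰d out with halts x
  ... | t , o , _ , h with Outputs-unique M′ x (_ , long x {t} x≰d h) out
  ... | refl = t , h

  answer-true : ∀ {x} (A? : Dec (A x)) → answer A? ≡ true → A x
  answer-true (yes p) _ = p

  answer-false : ∀ {x} (A? : Dec (A x)) → answer A? ≡ false → ¬ A x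
  answer-false (no ¬p) _ = ¬p

  pd′ : PartialDecision A M′
  pd′ x with length x ≤? d
  ... | yes x≤d = (λ out → answer-true (A? x) (Maybe.just-injective (Outputs-unique M′ x (_ , short x x≤d) out)))
                , (λ out → answer-false (A? x) (Maybe.just-injective (Outputs-unique M′ x (_ , short x x≤d) out)))
  ... | no x≰d  = (λ out → proj₁ (pd x) (long⁻ x x≰d out)) , (λ out → proj₂ (pd x) (long⁻ x x≰d out))

  halts′ : ∀ x → ∃ λ t → ∃ λ o → t ≤ a′ * length x ^ c + a′ × HaltsWithin M′ x t o
  halts′ x with length x ≤? d
  ... | yes x≤d = _ , _ , bound , short x x≤d
    where
    bound : suc d ≤ a′ * length x ^ c + a′
    bound = ≤-trans (s≤s (m≤m+n d d)) (≤-trans (m≤m+n (suc (d + d)) a) (m≤n+m a′ _))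
  ... | no x≰d with halts x
  ... | t , o , t≤ , h = _ , _ , bound , long x {t} x≰d h
    where
    open ≤-Reasoning
    L = length x ^ c
    bound : suc (d + (d + t)) ≤ a′ * L + a′
    bound = begin
      suc (d + (d + t))              ≡⟨ cong suc (sym (+-assoc d d t)) ⟩
      suc (d + d) + t                ≤⟨ +-monoʳ-≤ (suc (d + d)) t≤ ⟩
      suc (d + d) + (a * L + a)      ≡⟨ sym (+-assoc (suc (d + d)) (a * L) a) ⟩
      suc (d + d) + a * L + a        ≡⟨ cong (_+ a) (+-comm (suc (d + d)) (a * L)) ⟩
      a * L + suc (d + d) + a        ≡⟨ +-assoc (a * L) (suc (d + d)) a ⟩
      a * L + a′                     ≤⟨ +-monoˡ-≤ a′ (*-monoˡ-≤ L (m≤n+m a (suc (d + d)))) ⟩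
      a′ * L + a′                    ∎

  iff′ : ∀ x → ((S ∪≤ d) x → dom M′ x) × (dom M′ x → (S ∪≤ d) x)
  iff′ x with length x ≤? d
  ... | yes x≤d = (λ _ → dom-just M′ x _ (_ , short x x≤d)) , λ _ → inj₂ x≤d
  ... | no x≰d  = to , from
    where
    to : (S ∪≤ d) x → dom M′ x
    to (inj₂ x≤d) = contradiction x≤d x≰d
    to (inj₁ s) with dom-output M x (proj₁ (iff x) s)
    ... | b , t , h = dom-just M′ x b (_ , long x {t} x≰d h)
    from : dom M′ x → (S ∪≤ d) x
    from h with dom-output M′ x h
    ... | b , out = inj₁ (proj₂ (iff x) (dom-just M x b (long⁻ x x≰d out)))

-- Omniscient types

-- For `ℕ` this is the limited principle of omniscience.
Omniscient : Set → Set₁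
Omniscient X = ∀ {P : X → Set} → (∀ x → Dec (P x)) → Dec (∃ P)

omniscient-¬∀⇒∃¬ : ∀ {X} → Omniscient X → ∀ {P : X → Set} → (∀ x → Dec (P x)) →
  ¬ (∀ x → P x) → ∃ λ x → ¬ P x
omniscient-¬∀⇒∃¬ omn P? ¬all = decidable-stable (omn (¬? ∘ P?)) λ none →
  ¬all λ x → decidable-stable (P? x) λ ¬p → none (x , ¬p)

omniscient-∀ : ∀ {X} → Omniscient X → ∀ {P : X → Set} → (∀ x → Dec (P x)) → Dec (∀ x → P x)
omniscient-∀ omn P? with omn (¬? ∘ P?)
... | yes (x , ¬p) = no λ all → ¬p (all x)
... | no none      = yes λ x → decidable-stable (P? x) λ ¬p → none (x , ¬p)

omniscient-retract : ∀ {X Y : Set} (f : X → Y) (g : Y → X) → (∀ y → f (g y) ≡ y) →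
  Omniscient X → Omniscient Y
omniscient-retract f g fg omn {P} P? =
  map′ (λ (x , p) → f x , p) (λ (y , p) → g y , subst P (sym (fg y)) p) (omn (P? ∘ f))

omniscient-Σ : ∀ {X : Set} {Y : X → Set} → Omniscient X → (∀ x → Omniscient (Y x)) → Omniscient (Σ X Y)
omniscient-Σ omnX omnY P? =
  map′ (λ (x , y , p) → (x , y) , p) (λ ((x , y) , p) → x , y , p)
       (omnX λ x → omnY x λ y → P? (x , y))

omniscient-Fin : ∀ n → Omniscient (Fin n)
omniscient-Fin n = Fin.any?

omniscient-Vec : ∀ {X} → Omniscient X → ∀ n → Omniscient (Vec X n)
omniscient-Vec omn zero    P? = map′ (λ p → [] , p) (λ where ([] , p) → p) (P? [])
omniscient-Vec omn (suc n) =
  omniscient-retract (λ (x , v) → x ∷ v) (λ where (x ∷ v) → x , v) (λ where (x ∷ v) → refl)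
    (omniscient-Σ omn λ _ → omniscient-Vec omn n)

omniscient-Bool : Omniscient Bool
omniscient-Bool = omniscient-retract (λ where zero → false ; (suc zero) → true)
  (λ where false → zero ; true → suc zero) (λ where false → refl ; true → refl) (omniscient-Fin 2)

omniscient-MaybeBool : Omniscient (Maybe Bool)
omniscient-MaybeBool = omniscient-retract
  (λ where zero → nothing ; (suc zero) → just false ; (suc (suc zero)) → just true)
  (λ where nothing → zero ; (just false) → suc zero ; (just true) → suc (suc zero))
  (λ where nothing → refl ; (just false) → refl ; (just true) → refl) (omniscient-Fin 3)

symbol : Fin 3 → Sym
symbol zero             = blank
symbol (suc zero)       = b0
symbol (suc (suc zero)) = b1

index : Sym → Fin 3
index blank = zero
index b0    = suc zero
index b1    = suc (suc zero)

symbol-index : ∀ s → symbol (index s) ≡ s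
symbol-index blank = refl
symbol-index b0    = refl
symbol-index b1    = refl

omniscient-Sym : Omniscient Sym
omniscient-Sym = omniscient-retract symbol index symbol-index (omniscient-Fin 3)

omniscient-Move : Omniscient Move
omniscient-Move = omniscient-retract
  (λ where zero → left ; (suc zero) → right ; (suc (suc zero)) → stay)
  (λ where left → zero ; right → suc zero ; stay → suc (suc zero))
  (λ where left → refl ; right → refl ; stay → refl) (omniscient-Fin 3)

omniscient-Step : ∀ Q K → Omniscient (Step Q K)
omniscient-Step Q K {P} P? with omniscient-MaybeBool (P? ∘ halt)
... | yes (o , p) = yes (halt o , p)
... | no ¬halt    = map′ (λ ((q , ws , ms) , p) → go q ws ms , p) from
  (omniscient-Σ (omniscient-Fin (suc Q)) (λ _ →
    omniscient-Σ (omniscient-Vec omniscient-Sym (suc K)) (λ _ →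
      omniscient-Vec omniscient-Move (suc K))) (λ (q , ws , ms) → P? (go q ws ms)))
  where
  from : ∃ P → ∃ λ ((q , ws , ms) : Fin (suc Q) × Vec Sym (suc K) × Vec Move (suc K)) → P (go q ws ms)
  from (halt o , p)     = contradiction (o , p) ¬halt
  from (go q ws ms , p) = (q , ws , ms) , p

-- Finite tables and first-order codes of machines.

Table : ℕ → Set → Set
Table zero    X = X
Table (suc n) X = Vec (Table n X) 3

readTable : ∀ {X} n → Table n X → Vec Sym n → X
readTable zero    T []      = T
readTable (suc n) T (s ∷ v) = readTable n (lookup T (index s)) v

makeTable : ∀ {X} n → (Vec Sym n → X) → Table n X
makeTable zero    f = f []
makeTable (suc n) f = tabulate λ i → makeTable n λ v → f (symbol i ∷ v)

read-make : ∀ {X} n (f : Vec Sym n → X) v → readTable n (makeTable n f) v ≡ f v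
read-make zero    f []      = refl
read-make (suc n) f (s ∷ v)
  rewrite Vec.lookup∘tabulate (λ i → makeTable n λ v → f (symbol i ∷ v)) (index s) =
  trans (read-make n _ v) (cong (λ s → f (s ∷ v)) (symbol-index s))

omniscient-Table : ∀ {X} → Omniscient X → ∀ n → Omniscient (Table n X)
omniscient-Table omn zero    = omn
omniscient-Table omn (suc n) = omniscient-Vec (omniscient-Table omn n) 3

-- First-order presentations of machines: without function extensionality,
-- machines can only be searched up to pointwise equality of δ.
Code : Set
Code = Σ ℕ λ K → Σ ℕ λ Q → Vec (Table (suc K) (Step Q K)) (suc Q)

decode : Code → TM
decode (K , Q , T) = record { K = K ; Q = Q ; δ = λ q → readTable (suc K) (lookup T q) }

encode : TM → Code
encode M = TM.K M , TM.Q M , tabulate λ q → makeTable (suc (TM.K M)) (TM.δ M q)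

run-decode-encode : ∀ M t c → run (decode (encode M)) t c ≡ run M t c
run-decode-encode M t (q , ts) =
  run-embed (program M) (program (decode (encode M))) id δ-eq t q ts
  where
  δ-eq : ∀ q s → TM.δ (decode (encode M)) q s ≡ mapStep id (TM.δ M q s)
  δ-eq q s rewrite Vec.lookup∘tabulate (λ q → makeTable (suc (TM.K M)) (TM.δ M q)) q =
    trans (read-make (suc (TM.K M)) (TM.δ M q) s) (mapStep-id _)

Slice-code : ∀ c {A S} → Slice c A S → ∃ λ m →
  Approx c A (decode m) × (∀ x → (S x → dom (decode m) x) × (dom (decode m) x → S x))
Slice-code c {A} {S} (M , (pd , a , halts) , iff) = encode M , (pd′ , a , halts′) , iff′
  where
  M′ = decode (encode M)
  to : ∀ {x o} → Outputs M x o → Outputs M′ x o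
  to (t , h) = t , trans (run-decode-encode M t _) h
  from : ∀ {x o} → Outputs M′ x o → Outputs M x o
  from (t , h) = t , trans (sym (run-decode-encode M t _)) h
  pd′ : PartialDecision A M′
  pd′ x = proj₁ (pd x) ∘ from , proj₂ (pd x) ∘ from
  halts′ : ∀ x → ∃ λ t → ∃ λ o → t ≤ a * length x ^ c + a × HaltsWithin M′ x t o
  halts′ x with halts x
  ... | t , o , t≤ , h = t , o , t≤ , proj₂ (to (t , h))
  iff′ : ∀ x → (S x → dom M′ x) × (dom M′ x → S x)
  iff′ x = Data.Sum.map to to ∘ proj₁ (iff x) , proj₂ (iff x) ∘ Data.Sum.map from from

omniscient-Str : Omniscient ℕ → Omniscient Str⁺
omniscient-Str omn = omniscient-retract (λ (b , n , v) → b ∷ toList v)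
  (λ where (b ∷ l) → b , List.length l , fromList l)
  (λ where (b ∷ l) → cong (b ∷_) (Vec.toList∘fromList l))
  (omniscient-Σ omniscient-Bool λ _ → omniscient-Σ omn (omniscient-Vec omniscient-Bool))

omniscient-Code : Omniscient ℕ → Omniscient Code
omniscient-Code omn = omniscient-Σ omn λ K → omniscient-Σ omn λ Q →
  omniscient-Vec (omniscient-Table (omniscient-Step Q K) (suc K)) (suc Q)

-- Deciding whether a clocked machine approximates `A`.

module _ {A : SetStr} (A? : ∀ x → Dec (A x)) where

  CorrectAt : TM → ℕ → Str⁺ → Set
  CorrectAt M t x = ∃ λ o → HaltsWithin M x t o × (o ≡ just true → A x) × (o ≡ just false → ¬ A x)

  -- Once the coefficient `a` is fixed, one run of known length settles correctness at a string,
  -- whereas `Approx` speaks of runs of any length.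
  Valid : TM → ℕ → ℕ → Set
  Valid M c a = ∀ x → CorrectAt M (a * length x ^ c + a) x

  valid? : Omniscient ℕ → ∀ M c a → Dec (Valid M c a)
  valid? omn M c a = omniscient-∀ (omniscient-Str omn) λ x → omniscient-MaybeBool λ o →
    Maybe.≡-dec ≟ᵒ (run M (a * length x ^ c + a) (initConfig M x)) (just o)
    ×-dec ((≟ᵒ o (just true) →-dec A? x) ×-dec (≟ᵒ o (just false) →-dec ¬? (A? x)))
    where
    ≟ᵒ : DecidableEquality (Maybe Bool)
    ≟ᵒ = Maybe.≡-dec Bool._≟_

  Valid⇒Approx : ∀ M c a → Valid M c a → Approx c A M
  Valid⇒Approx M c a valid = pd , a , λ x → a * length x ^ c + a , proj₁ (valid x) , ≤-refl , proj₁ (proj₂ (valid x))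
    where
    pd : PartialDecision A M
    pd x with valid x
    ... | o , h , if-true , if-false =
      if-true ∘ Outputs-unique M x (a * length x ^ c + a , h) , if-false ∘ Outputs-unique M x (a * length x ^ c + a , h)

  Approx⇒Valid : ∀ M c → Approx c A M → ∃ λ a → Valid M c a
  Approx⇒Valid M c (pd , a , halts) = a , valid
    where
    valid : Valid M c a
    valid x with halts x
    ... | t , o , t≤ , h = o , run-mono M _ t≤ h
      , (λ where refl → proj₁ (pd x) (t , h)) , (λ where refl → proj₂ (pd x) (t , h))

-- A positive form of the infinitude of `S ∖ T`: each length admits only finitely many strings.
InfinitelyExceeds : SetStr → SetStr → Set
InfinitelyExceeds S T = ∀ n → ∃ λ x → n ≤ length x × (S ∖ T) x

InfinitelyExceeds⇒Infinite : ∀ {S S′ T} → (∀ x → S x → S′ x) → InfinitelyExceeds S T → Infinite (S′ ∖ T)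
InfinitelyExceeds⇒Infinite S⊆S′ exceeds (l , complete) with length-bound l
... | n , bound with exceeds (suc n)
... | x , n<x , s , ¬t = <⇒≱ n<x (bound x (complete x (S⊆S′ x s , ¬t)))

¬InfinitelyExceeds⇒Finite : Omniscient ℕ → ∀ {S T} → (∀ x → Dec (S x)) → (∀ x → Dec (T x)) →
  ¬ InfinitelyExceeds S T → Finite (S ∖ T)
¬InfinitelyExceeds⇒Finite omn S? T? ¬exceeds
  with omniscient-¬∀⇒∃¬ omn
         (λ n → omniscient-Str omn λ x → n ≤? length x ×-dec (S? x ×-dec ¬? (T? x))) ¬exceeds
... | n , none = strings≤ n , λ x x∈ → ∈-strings≤ n x (≮⇒≥ λ n<x → none (x , <⇒≤ n<x , x∈))

-- Parameterizations

Least : (ℕ → Set) → ℕ → Set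
Least P n = P n × (∀ {m} → m < n → ¬ P m)

Least-unique : ∀ {P m n} → Least P m → Least P n → m ≡ n
Least-unique {m = m} {n} (p , p<) (q , q<) with <-cmp m n
... | tri< m<n _ _ = contradiction p (q< m<n)
... | tri≈ _ m≡n _ = m≡n
... | tri> _ _ n<m = contradiction q (p< n<m)

-- The least number principle in negated form; strong induction gives it without decidability of
-- `P`.
¬∃Least : ∀ {P : ℕ → Set} → ¬ (∃ (Least P)) → ∀ n → ¬ P n
¬∃Least {P} none = <-rec (λ n → ¬ P n) λ n rec p → none (n , p , λ {m} m<n → rec {m} m<n)

-- Slices S ∪ {x : |x| ≤ b}, where a code of length 1 is reserved for the
-- parameter whose b is the (at most one) element of W.  Whether W has an
-- element need not be known.
module Padded (S : SetStr) (W : ℕ → Set) (W-unique : ∀ {m n} → W m → W n → m ≡ n) where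

  data Ω : Set where
    plain   : ℕ → Ω
    special : (n : ℕ) → .(W n) → Ω

  size : Ω → ℕ
  size (plain n)     = n
  size (special n _) = n

  enc : Ω → Str⁺
  enc (plain n)     = false ∷ List.replicate n false
  enc (special _ _) = true ∷ []

  -- The proofs of `W` are irrelevant, so `m ≡ n` has to be recovered by `recompute` from decidable
  -- equality on `ℕ`.
  special-injective : ∀ m n .(w : W m) .(w′ : W n) → special m w ≡ special n w′
  special-injective m n w w′ with recompute (m ≟ n) (W-unique w w′)
  ... | refl = refl

  enc-injective : ∀ {i j} → enc i ≡ enc j → i ≡ j
  enc-injective {plain m}     {plain n}      e = cong plain
    (trans (sym (List.length-replicate m))
      (trans (suc-injective (cong length e)) (List.length-replicate n)))
  enc-injective {special m w} {special n w′} _ = special-injective m n w w′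

  padded : Parameterization
  padded = record
    { space = record
      { Ω       = Ω
      ; _≼_     = λ i j → size i ≤ size j
      ; ≼-refl  = λ _ → ≤-refl
      ; ≼-trans = ≤-trans
      ; ≼-dir   = λ i j → plain (size i ⊔ size j) , m≤m⊔n (size i) _ , m≤n⊔m (size i) _
      ; point   = plain 0
      ; enc     = enc
      ; enc-inj = enc-injective
      }
    ; η    = λ x k → (S ∪≤ size k) x
    ; η-ne = λ x → plain (length x) , inj₂ ≤-refl
    ; η-up = λ where
        (inj₁ s) _ → inj₁ s
        (inj₂ h) k≼k′ → inj₂ (≤-trans h k≼k′)
    }

open Parameterization

-- `True X?` has at most one element, unlike `X`. This lets `cover` choose one parameter per string
-- and search over the choices.
omniscient-True : ∀ {X : Set} (X? : Dec X) → Omniscient (True X?)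
omniscient-True (yes _) P? = map′ (λ p → tt , p) proj₂ (P? tt)
omniscient-True (no _)  P? = no λ (t , _) → t

-- Only finitely many codes have length at most `m`. Omniscience decides which of them are chosen
-- for some member of `D`, and directedness bounds those from above.
cover : Omniscient ℕ → ∀ R {D : SetStr} → (∀ x → Dec (D x)) → ∀ m → (∀ x → D x → μ≤ R x m) →
  ∃ λ k → ∀ x → D x → slice R k x
cover omn R {D} D? m bounded = let k , above = upper (strings≤ m) in
  k , λ x d → let t = fromWitness {a? = D? x} d in
    let k′ , ηxk′ , k′≤m = bounded x (toWitness t) in
      η-up R ηxk′ (above x t (∈-strings≤ m (enc R k′) k′≤m))
  where
  key : ∀ x → True (D? x) → Ω R
  key x t = proj₁ (bounded x (toWitness t))

  upper : ∀ l → ∃ λ k → ∀ x t → enc R (key x t) ∈ l → _≼_ R (key x t) k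
  upper []      = point R , λ _ _ ()
  upper (σ ∷ l) with upper l
                   | omniscient-Str omn (λ x → omniscient-True (D? x) λ t → enc R (key x t) ≟ˢ σ)
  ... | k , above | no none = k , λ where
    x t (here e)   → contradiction (x , t , e) none
    x t (there t∈) → above x t t∈
  ... | k , above | yes (x₀ , t₀ , e₀) with ≼-dir R (key x₀ t₀) k
  ... | k′ , k₀≼k′ , k≼k′ = k′ , λ where
    x t (here e)   → subst (λ i → _≼_ R i k′) (enc-inj R (trans e₀ (sym e))) k₀≼k′
    x t (there t∈) → ≼-trans R (above x t t∈) k≼k′

-- The bound of `cover` under double negation, with excluded middle in place of omniscience; it is
-- used on the way to `lpo`.
¬¬-upper : ∀ R l → ¬ ¬ (∃ λ k* → ∀ k → enc R k ∈ l → _≼_ R k k*)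
¬¬-upper R []      none = none (point R , λ _ ())
¬¬-upper R (σ ∷ l) none = ¬¬-upper R l λ (k* , above) → ¬¬-excluded-middle λ where
  (no ∄k) → none (k* , λ where
    k (here e)   → contradiction (k , e) ∄k
    k (there k∈) → above k k∈)
  (yes (k₀ , e₀)) → let k′ , k₀≼k′ , k*≼k′ = ≼-dir R k₀ k* in none (k′ , λ where
    k (here e)   → subst (λ i → _≼_ R i k′) (enc-inj R (trans e₀ (sym e))) k₀≼k′
    k (there k∈) → ≼-trans R (above k k∈) k*≼k′)

-- Consequences of a minimum.

module _ {A : SetStr} (levelable : PLevelable A)
         (P : Parameterization) (c : ℕ) (fpt : FPTc c A P)
         (minimum : ∀ P′ → FPT A P′ → P ≼nu P′) where

  A? : ∀ x → Dec (A x)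
  A? x with η-ne P x
  ... | k , ηxk with fpt k
  ... | M , (pd , _) , iff with proj₁ (iff x) ηxk
  ... | inj₁ out = yes (proj₁ (pd x) out)
  ... | inj₂ out = no (proj₂ (pd x) out)

  -- A full slice would be maximal, as nothing lies outside it.
  no-full-slice : ∀ k → ¬ (∀ x → slice P k x)
  no-full-slice k full = levelable (slice P k , (c , fpt k) ,
    λ S′ _ → [] , λ x (_ , x∉) → contradiction (full x) x∉)

  -- Otherwise an upper bound of the parameters with codes of length at most `i` would have a full
  -- slice.
  μ-unbounded : ∀ i → ¬ ¬ (∃ λ x → ¬ μ≤ P x i)
  μ-unbounded i none = ¬¬-upper P (strings≤ i) λ (k* , above) →
    no-full-slice k* λ x → decidable-stable (Slice-dec c (fpt k*) x) λ x∉ →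
      none (x , λ (k , ηxk , k≤i) → x∉ (η-up P ηxk (above k (∈-strings≤ i (enc P k) k≤i))))

  absorb : ∀ c′ {S} → Slice c′ A S → (W : ℕ → Set) → (∀ {m n} → W m → W n → m ≡ n) →
    ∃ λ m → ∀ b → W b → ∀ x → (S ∪≤ b) x → μ≤ P x m
  absorb c′ {S} slice-S W W-unique =
    -- The final 1 is the length of the reserved code, so `m` is found before any element of `W` is.
    let m , bounded = minimum padded (c′ , λ k → Slice-∪≤ c′ A? (size k) slice-S) 1 in
    m , λ b w x x∈ → bounded x (special b w , x∈ , ≤-refl)
    where open Padded S W W-unique using (padded; size; special)

  -- The reserved parameter carries a slice that is not contained in
  -- {x : μ x ≤ i}, where i is the least element of Q.  Minimality of P bounds
  -- μ by some m on that slice, and m is obtained without knowing whether i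
  -- exists; then i < m, so only finitely many candidates remain.
  lpo : Omniscient ℕ
  lpo {Q} Q? = map′ (λ (i , _ , q) → i , q) (λ (i , q) → bound i q) (anyUpTo? Q? m)
    where
    Escapes : ℕ → ℕ → Set
    Escapes i b = ∃ λ x → length x ≤ b × ¬ μ≤ P x i

    -- Leastness in both places makes `W` have at most one element without any search.
    W : ℕ → Set
    W b = ∃ λ i → Least Q i × Least (Escapes i) b

    W-unique : ∀ {m n} → W m → W n → m ≡ n
    W-unique (i , li , lm) (j , lj , ln) with Least-unique li lj
    ... | refl = Least-unique lm ln

    -- Over the empty slice, the reserved slice is just the strings of length at most `b`.
    absorbed = absorb 0 (Slice-∅ A) W W-unique
    m = proj₁ absorbed

    least<m : ∀ i → Least Q i → i < m
    -- The goal is now absurdity, so an escaping string and a least `b` may be assumed although they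
    -- exist only under double negation.
    least<m i li = ≰⇒> λ m≤i → μ-unbounded i λ (x , x∉) →
      ¬∃Least {Escapes i} (λ (b , lb@((y , y≤b , y∉) , _)) →
        let k , ηyk , k≤m = proj₂ absorbed b (i , li , lb) y (inj₂ y≤b) in
        y∉ (k , ηyk , ≤-trans k≤m m≤i))
      (length x) (x , ≤-refl , x∉)

    bound : ∀ i → Q i → ∃ λ i → i < m × Q i
    -- The search below `m` is decidable, hence a doubly negated least element suffices.
    bound i q = decidable-stable (anyUpTo? Q? m) λ none →
      ¬∃Least (λ (j , lj) → none (j , least<m j lj , proj₁ lj)) i q

  slice⇒μ-bounded : ∀ c′ {S} → Slice c′ A S → ∃ λ m → ∀ x → S x → μ≤ P x m
  slice⇒μ-bounded c′ slice-S =
    -- The singleton `W` puts the reserved parameter in use, and its slice contains `S`.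
    let m , bounded = absorb c′ slice-S (_≡ 0) (λ p q → trans p (sym q)) in
    m , λ x s → bounded 0 refl x (inj₁ s)

  Candidate : SetStr → Code × ℕ × ℕ → Set
  Candidate T (m , d , a) = Valid A? (decode m) d a × InfinitelyExceeds (dom (decode m)) T

  exceeds? : ∀ {S T} → (∀ x → Dec (S x)) → (∀ x → Dec (T x)) → Dec (InfinitelyExceeds S T)
  exceeds? S? T? = omniscient-∀ lpo λ n → omniscient-Str lpo λ x →
    n ≤? length x ×-dec (S? x ×-dec ¬? (T? x))

  dom-slice : ∀ M d a → Valid A? M d a → Slice d A (dom M)
  dom-slice M d a valid = M , Valid⇒Approx A? M d a valid , λ _ → id , id

  candidate? : ∀ {T} → (∀ x → Dec (T x)) → ∀ n → Dec (Candidate T n)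
  candidate? T? (m , d , a) = valid? A? lpo (decode m) d a ×-dec′ λ valid →
    exceeds? (Slice-dec d (dom-slice (decode m) d a valid)) T?

  -- Levelability only refutes maximality of `T`. If the search through codes, exponents and
  -- coefficients failed, every P-slice would exceed `T` finitely, so `T` would be maximal.
  larger-slice : ∀ c′ {T} → Slice c′ A T → ∃ (Candidate T)
  larger-slice c′ {T} slice-T = decidable-stable
    (omniscient-Σ (omniscient-Code lpo) (λ _ → omniscient-Σ lpo λ _ → lpo) (candidate? T?))
    λ none → levelable (T , (c′ , slice-T) , λ where
      S (d , slice-S) → ¬InfinitelyExceeds⇒Finite lpo (Slice-dec d slice-S) T? λ exceeds →
        let m , approx , iff = Slice-code d slice-S
            a , valid = Approx⇒Valid A? (decode m) d approx
        in none ((m , d , a) , valid , λ n →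
             let x , n≤x , s , ¬t = exceeds n in x , n≤x , proj₁ (iff x) s , ¬t))
    where T? = Slice-dec c′ slice-T

  -- The two gap bounds compose and `cover` applies. The exponent of `S` is arbitrary because
  -- minimality ranges over all exponents, so `S` may be a slice of higher exponent than those of
  -- `P′`.
  slice-absorbed : ∀ P′ c′ {S} → P′ ≼nu P → Slice c′ A S → ∃ λ k → ∀ x → S x → slice P′ k x
  slice-absorbed P′ c′ P′≼P slice-S =
    let n , bounded = slice⇒μ-bounded c′ slice-S
        n′ , bounded′ = P′≼P n
    in cover lpo P′ (Slice-dec c′ slice-S) n′ λ x s → bounded′ x (bounded x s)

  imix : ∀ P′ c′ → P′ ≼nu P → FPTc c′ A P′ → Imix P′
  imix P′ c′ P′≼P fpt′ k = from-candidate (larger-slice c′ (fpt′ k))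
    where
    from-candidate : ∃ (Candidate (slice P′ k)) → ∃ λ k′ → Infinite (slice P′ k′ ∖ slice P′ k)
    from-candidate ((m , d , a) , valid , exceeds) =
      let k′ , S⊆k′ = slice-absorbed P′ d P′≼P (dom-slice (decode m) d a valid)
      in k′ , InfinitelyExceeds⇒Infinite S⊆k′ exceeds

theorem6 : (A : SetStr) → PLevelable A → ¬ FPTLevelable A →
    ¬ (Σ Parameterization λ P → FPT A P × (∀ P' → FPT A P' → P ≼nu P'))
theorem6 A levelable ¬fpt-levelable (P , (c , fpt) , minimum) =
  ¬fpt-levelable (c , λ c′ c≤c′ → P , (λ k → Slice-mono c c≤c′ (fpt k)) ,
    λ P′ → imix levelable P c fpt minimum P′ c′)
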